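{- Let $\Sigma$ be an alphabet and $\langle\Sigma\rangle$ the free group on $\Sigma$. An element of $\langle\Sigma\rangle$ is a product (in the group) of at most two palindromes if and only if its reduced form is equal, as a concatenation of words (i.e. with no cancellation performed), to $$A\,P\,Q\,A^{ -1}$$ for some (possibly empty) palindromes $P, Q$ and some (possibly empty) word $A$.
   Context: Let $\Sigma_g=\Sigma\cup\{a^{ -1} : a\in\Sigma\}$. Elements of $\langle\Sigma\rangle$ are represented by their reduced forms, i.e. words over $\Sigma_g$ in which no letter $a$ is adjacent to $a^{ -1}$. For a word $X=x_1x_2\cdots x_n$ with $x_i\in\Sigma_g$, the mirror image is $\overline{X}=x_n\cdots x_2x_1$, and the inverse is $X^{ -1}=x_n^{ -1}\cdots x_1^{ -1}$ with $(a^{ -1})^{ -1}=a$. A palindrome is a word $P$ with $P=\overline{P}$; the empty word is a palindrome. An element of $\langle\Sigma\rangle$ is called a palindrome if its reduced form is a palindrome. "The reduced form is a concatenation of the form $W_1W_2\cdots W_m$" means that the reduced word equals the literal concatenation of the words $W_1,\dots,W_m$ over $\Sigma_g$ (so this concatenation is itself reduced). -}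

module Defs where

open import Algebra.Bundles using (Group)
open import Data.List.Base using (List; []; _∷_; [_]; _++_; _∷ʳ_; length; foldr; map; reverse)
open import Data.List.Properties
  using (++-assoc; ++-identityʳ; unfold-reverse)
open import Data.List.Relation.Unary.All using (All)
open import Data.List.Relation.Unary.Linked as Linked using (Linked; []; [-]; _∷_)
open import Data.Nat.Base using (_≤_)
open import Data.Product.Base using (_,_; _×_; ∃-syntax)
open import Level using (Level)
open import Relation.Binary.Core using (Rel)
open import Relation.Binary.Definitions using (DecidableEquality)
open import Relation.Binary.Construct.Closure.Equivalence as EqC using (EqClosure)
open import Relation.Binary.Construct.Closure.ReflexiveTransitive using (ε; _◅_; _◅◅_)
open import Relation.Binary.Construct.Closure.Symmetric using (fwd; bwd)
open import Relation.Binary.PropositionalEquality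
  using (_≡_; _≢_; refl; sym; trans; cong; subst₂; isEquivalence; module ≡-Reasoning)
open import Relation.Nullary using (yes; no; contradiction)

private
  variable
    a : Level

data Letter (Σ : Set a) : Set a where
  gen gen⁻¹ : Σ → Letter Σ

Word : Set a → Set a
Word Σ = List (Letter Σ)

module _ {Σ : Set a} where

  invˡ : Letter Σ → Letter Σ
  invˡ (gen s)   = gen⁻¹ s
  invˡ (gen⁻¹ s) = gen s

  inv : Word Σ → Word Σ
  inv w = reverse (map invˡ w)

  Palindrome : Word Σ → Set a
  Palindrome w = w ≡ reverse w

  Reduced : Word Σ → Set a
  Reduced = Linked (λ x y → y ≢ invˡ x)

  infix 4 _⟶_ _≈_

  data _⟶_ : Rel (Word Σ) a where
    cancel : ∀ u x v → u ++ x ∷ invˡ x ∷ v ⟶ u ++ v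

  _≈_ : Rel (Word Σ) a
  _≈_ = EqClosure _⟶_

  invˡ-involutive : ∀ x → invˡ (invˡ x) ≡ x
  invˡ-involutive (gen s)   = refl
  invˡ-involutive (gen⁻¹ s) = refl

  inv-∷ : ∀ x w → inv (x ∷ w) ≡ inv w ∷ʳ invˡ x
  inv-∷ x w = unfold-reverse (invˡ x) (map invˡ w)

  ≈-reflexive : ∀ {u v} → u ≡ v → u ≈ v
  ≈-reflexive refl = ε

  ≈-sym : ∀ {u v} → u ≈ v → v ≈ u
  ≈-sym = EqC.symmetric _⟶_

  ++-congˡ : ∀ w {u v} → u ≈ v → w ++ u ≈ w ++ v
  ++-congˡ w = EqC.gmap (w ++_) step
    where
    step : ∀ {u v} → u ⟶ v → w ++ u ⟶ w ++ v
    step (cancel u x v) =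
      subst₂ _⟶_ (++-assoc w u _) (++-assoc w u v) (cancel (w ++ u) x v)

  ++-congʳ : ∀ w {u v} → u ≈ v → u ++ w ≈ v ++ w
  ++-congʳ w = EqC.gmap (_++ w) step
    where
    step : ∀ {u v} → u ⟶ v → u ++ w ⟶ v ++ w
    step (cancel u x v) =
      subst₂ _⟶_ (sym (++-assoc u _ w)) (sym (++-assoc u v w)) (cancel u x (v ++ w))

  ++-cong : ∀ {u u′ v v′} → u ≈ u′ → v ≈ v′ → u ++ v ≈ u′ ++ v′
  ++-cong {u′ = u′} {v = v} p q = ++-congʳ v p ◅◅ ++-congˡ u′ q

  ++-inverseˡ : ∀ w → inv w ++ w ≈ []
  ++-inverseˡ []      = ε
  ++-inverseˡ (x ∷ w) =
    ≈-reflexive (begin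
      inv (x ∷ w) ++ x ∷ w                       ≡⟨ cong (_++ x ∷ w) (inv-∷ x w) ⟩
      (inv w ∷ʳ invˡ x) ++ x ∷ w                 ≡⟨ ++-assoc (inv w) _ _ ⟩
      inv w ++ invˡ x ∷ x ∷ w                    ≡⟨ cong (λ y → inv w ++ invˡ x ∷ y ∷ w) (invˡ-involutive x) ⟨
      inv w ++ invˡ x ∷ invˡ (invˡ x) ∷ w        ∎)
    ◅◅ fwd (cancel (inv w) (invˡ x) w) ◅ ++-inverseˡ w
    where open ≡-Reasoning

  ++-inverseʳ : ∀ w → w ++ inv w ≈ []
  ++-inverseʳ []      = ε
  ++-inverseʳ (x ∷ w) =
    ≈-reflexive (cong (x ∷_) (trans (cong (w ++_) (inv-∷ x w)) (sym (++-assoc w (inv w) _))))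
    ◅◅ ++-congˡ [ x ] (++-congʳ [ invˡ x ] (++-inverseʳ w))
    ◅◅ fwd (cancel [] x []) ◅ ε

  inv-cong : ∀ {u v} → u ≈ v → inv u ≈ inv v
  inv-cong {u} {v} p =
    ≈-reflexive (sym (++-identityʳ (inv u)))
    ◅◅ ++-congˡ (inv u) (≈-sym (++-inverseʳ v))
    ◅◅ ≈-reflexive (sym (++-assoc (inv u) v (inv v)))
    ◅◅ ++-congʳ (inv v) (++-congˡ (inv u) (≈-sym p) ◅◅ ++-inverseˡ u)

freeGroup : Set a → Group a a
freeGroup Σ = record
  { Carrier = Word Σ
  ; _≈_     = _≈_
  ; _∙_     = _++_
  ; ε       = []
  ; _⁻¹     = inv
  ; isGroup = record
    { isMonoid = record
      { isSemigroup = record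
        { isMagma = record
          { isEquivalence = EqC.isEquivalence _⟶_
          ; ∙-cong        = ++-cong
          }
        ; assoc = λ u v w → ≈-reflexive (++-assoc u v w)
        }
      ; identity = (λ _ → ε) , (λ w → ≈-reflexive (++-identityʳ w))
      }
    ; inverse = ++-inverseˡ , ++-inverseʳ
    ; ⁻¹-cong = inv-cong
    }
  }

module ReducedForm {Σ : Set a} (_≟_ : DecidableEquality Σ) where

  _≟ˡ_ : DecidableEquality (Letter Σ)
  gen s   ≟ˡ gen t with s ≟ t
  ... | yes refl = yes refl
  ... | no  s≢t  = no λ { refl → s≢t refl }
  gen s   ≟ˡ gen⁻¹ t = no λ ()
  gen⁻¹ s ≟ˡ gen t   = no λ ()
  gen⁻¹ s ≟ˡ gen⁻¹ t with s ≟ t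
  ... | yes refl = yes refl
  ... | no  s≢t  = no λ { refl → s≢t refl }

  cons : Letter Σ → Word Σ → Word Σ
  cons x []      = [ x ]
  cons x (y ∷ w) with y ≟ˡ invˡ x
  ... | yes _ = w
  ... | no  _ = x ∷ y ∷ w

  reducedForm : Word Σ → Word Σ
  reducedForm = foldr cons []

  cons-reduced : ∀ x {w} → Reduced w → Reduced (cons x w)
  cons-reduced x {[]}    _ = [-]
  cons-reduced x {y ∷ w} r with y ≟ˡ invˡ x
  ... | yes _   = Linked.tail r
  ... | no  y≢x = y≢x ∷ r

  cons-≈ : ∀ x w → x ∷ w ≈ cons x w
  cons-≈ x []      = ε
  cons-≈ x (y ∷ w) with y ≟ˡ invˡ x
  ... | yes refl = fwd (cancel [] x w) ◅ ε
  ... | no  _    = ε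

  cons-∷ : ∀ {x w} → Reduced (x ∷ w) → cons x w ≡ x ∷ w
  cons-∷ {x} {[]}    _         = refl
  cons-∷ {x} {y ∷ w} (y≢x ∷ _) with y ≟ˡ invˡ x
  ... | yes y≡x = contradiction y≡x y≢x
  ... | no  _   = refl

  cons-cancel : ∀ x w → cons x (invˡ x ∷ w) ≡ w
  cons-cancel x w with invˡ x ≟ˡ invˡ x
  ... | yes _   = refl
  ... | no  x≢x = contradiction refl x≢x

  cons-cons-inv : ∀ x {w} → Reduced w → cons x (cons (invˡ x) w) ≡ w
  cons-cons-inv x {[]}    _ = cons-cancel x []
  cons-cons-inv x {y ∷ w} r with y ≟ˡ invˡ (invˡ x)
  ... | no  _ = cons-cancel x (y ∷ w)
  ... | yes y≡x⁻¹⁻¹ with refl ← trans y≡x⁻¹⁻¹ (invˡ-involutive x) = cons-∷ r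

  reducedForm-reduced : ∀ w → Reduced (reducedForm w)
  reducedForm-reduced []      = []
  reducedForm-reduced (x ∷ w) = cons-reduced x (reducedForm-reduced w)

  reducedForm-≈ : ∀ w → w ≈ reducedForm w
  reducedForm-≈ []      = ε
  reducedForm-≈ (x ∷ w) = ++-congˡ [ x ] (reducedForm-≈ w) ◅◅ cons-≈ x (reducedForm w)

  reducedForm-id : ∀ {w} → Reduced w → reducedForm w ≡ w
  reducedForm-id {[]}    _ = refl
  reducedForm-id {x ∷ w} r =
    trans (cong (cons x) (reducedForm-id (Linked.tail r))) (cons-∷ r)

  reducedForm-⟶ : ∀ {u v} → u ⟶ v → reducedForm u ≡ reducedForm v
  reducedForm-⟶ (cancel []      x v) = cons-cons-inv x (reducedForm-reduced v)
  reducedForm-⟶ (cancel (y ∷ u) x v) = cong (cons y) (reducedForm-⟶ (cancel u x v))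

  reducedForm-cong : ∀ {u v} → u ≈ v → reducedForm u ≡ reducedForm v
  reducedForm-cong = EqC.gfold isEquivalence reducedForm reducedForm-⟶

  reducedForm-unique : ∀ {g w} → Reduced w → g ≈ w → reducedForm g ≡ w
  reducedForm-unique r g≈w = trans (reducedForm-cong g≈w) (reducedForm-id r)

  open Group (freeGroup Σ) using (Carrier; _∙_) renaming (ε to 1#; _≈_ to _≈ᴳ_)

  -- A group element is a palindrome when its reduced form is, not when the
  -- given representative is.
  IsPalindrome : Carrier → Set a
  IsPalindrome g = Palindrome (reducedForm g)

  IsProductOfAtMostTwoPalindromes : Carrier → Set a
  IsProductOfAtMostTwoPalindromes g =
    ∃[ ps ] length ps ≤ 2 × All IsPalindrome ps × g ≈ᴳ foldr _∙_ 1# ps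

{-# OPTIONS --safe #-}

-- Words of the form A P Q A⁻¹ are closed, up to reduction, under conjugation by
-- a letter x: cancellation with the core P Q = (x⁻¹ P′ x⁻¹) Q only rebalances it
-- to P′ (x⁻¹ Q x⁻¹), and cancellation on the right is the mirror image of this.
-- Since (x p x) q = x (p (x q x)) x⁻¹, induction on the first palindrome then
-- reduces every product of two palindromes to this closure.
-- Conversely A P Q A⁻¹ is the product of A P Ā and Ā⁻¹ Q A⁻¹, and reduction
-- commutes with reversal, so it keeps palindromes palindromic.
module Submission where

open import Defs
open import Algebra.Bundles using (Group)
open import Data.List.Base using (List; []; _∷_; [_]; _++_; _∷ʳ_; map; reverse)
open import Data.List.Properties
  using (++-assoc; ++-identityʳ; unfold-reverse; reverse-++; reverse-involutive;
         map-∘; map-id; map-cong; ∷-injective; ∷ʳ-injectiveˡ)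
open import Data.List.Relation.Unary.All using ([]; _∷_)
open import Data.List.Relation.Unary.Linked as Linked using ([]; [-]; _∷_)
open import Data.Nat.Base using (s≤s; z≤n)
open import Data.Product.Base using (_,_; _×_; ∃-syntax)
open import Data.Sum.Base using (_⊎_; inj₁; inj₂)
open import Function.Bundles using (_⇔_; mk⇔)
open import Level using (Level)
import Relation.Binary.Construct.Closure.Equivalence as EqC
open import Relation.Binary.Construct.Closure.ReflexiveTransitive using (ε; _◅_; _◅◅_)
open import Relation.Binary.Construct.Closure.Symmetric using (fwd)
open import Relation.Binary.Definitions using (DecidableEquality)
open import Relation.Binary.PropositionalEquality
  using (_≡_; _≢_; refl; sym; trans; cong; cong₂; subst; module ≡-Reasoning)
import Relation.Binary.Reasoning.Setoid as ≈-Reasoning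
open import Relation.Nullary using (yes; no)

private
  variable
    a : Level
    A Σ : Set a

-- Palindromes, read from both ends inwards

reverse-∷ʳ : ∀ (w : List A) x → reverse (w ∷ʳ x) ≡ x ∷ reverse w
reverse-∷ʳ w x = reverse-++ w [ x ]

reverse-∷-∷ʳ : ∀ (x : A) w y → reverse (x ∷ w ∷ʳ y) ≡ y ∷ reverse w ∷ʳ x
reverse-∷-∷ʳ x w y = trans (unfold-reverse x (w ∷ʳ y)) (cong (_∷ʳ x) (reverse-∷ʳ w y))

data Ends {A : Set a} : List A → Set a where
  nil    : Ends []
  single : ∀ x → Ends [ x ]
  both   : ∀ x {w} → Ends w → ∀ y → Ends (x ∷ w ∷ʳ y)

ends-∷ : ∀ (x : A) {w} → Ends w → Ends (x ∷ w)
ends-∷ x nil          = single x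
ends-∷ x (single y)   = both x nil y
ends-∷ x (both y e z) = both x (ends-∷ y e) z

ends : ∀ (w : List A) → Ends w
ends []      = nil
ends (x ∷ w) = ends-∷ x (ends w)

-- Inductive counterpart of `w ≡ reverse w`: matching on `wrap` makes the two end letters equal and
-- leaves a shorter palindrome to recurse on.
data Pal {Σ : Set a} : Word Σ → Set a where
  nil    : Pal []
  single : ∀ x → Pal [ x ]
  wrap   : ∀ x {w} → Pal w → Pal (x ∷ w ∷ʳ x)

pal⇒palindrome : {w : Word Σ} → Pal w → Palindrome w
pal⇒palindrome nil        = refl
pal⇒palindrome (single x) = refl
pal⇒palindrome (wrap x {w} p) =
  trans (cong (λ v → x ∷ v ∷ʳ x) (pal⇒palindrome p)) (sym (reverse-∷-∷ʳ x w x))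

ends⇒pal : {w : Word Σ} → Ends w → Palindrome w → Pal w
ends⇒pal nil        _ = nil
ends⇒pal (single x) _ = single x
ends⇒pal (both x {w} e y) eq
  with refl , eq′ ← ∷-injective (trans eq (reverse-∷-∷ʳ x w y)) =
  wrap x (ends⇒pal e (∷ʳ-injectiveˡ w (reverse w) eq′))

palindrome⇒pal : {w : Word Σ} → Palindrome w → Pal w
palindrome⇒pal {w = w} = ends⇒pal (ends w)

-- Reduced words

≢-invˡ-sym : {x y : Letter Σ} → y ≢ invˡ x → x ≢ invˡ y
≢-invˡ-sym y≢x⁻¹ refl = y≢x⁻¹ (sym (invˡ-involutive _))

x≢x⁻¹ : (x : Letter Σ) → x ≢ invˡ x
x≢x⁻¹ (gen _)   ()
x≢x⁻¹ (gen⁻¹ _) ()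

reduced-++ˡ : ∀ (u : Word Σ) {v} → Reduced (u ++ v) → Reduced u
reduced-++ˡ []          _       = []
reduced-++ˡ (x ∷ [])    _       = [-]
reduced-++ˡ (x ∷ y ∷ u) (h ∷ r) = h ∷ reduced-++ˡ (y ∷ u) r

reduced-++ʳ : ∀ (u : Word Σ) {v} → Reduced (u ++ v) → Reduced v
reduced-++ʳ []      r = r
reduced-++ʳ (_ ∷ u) r = reduced-++ʳ u (Linked.tail r)

-- Reducedness only concerns adjacent pairs, and since the two pieces overlap in `y`, every adjacent
-- pair lies inside one of them.
reduced-glue : ∀ (u : Word Σ) {y v} → Reduced (u ∷ʳ y) → Reduced (y ∷ v) → Reduced (u ++ y ∷ v)
reduced-glue []          _       s = s
reduced-glue (x ∷ [])    (h ∷ _) s = h ∷ s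
reduced-glue (x ∷ z ∷ u) (h ∷ r) s = h ∷ reduced-glue (z ∷ u) r s

reduced-reverse : {w : Word Σ} → Reduced w → Reduced (reverse w)
reduced-reverse []  = []
reduced-reverse [-] = [-]
reduced-reverse {w = x ∷ y ∷ w} (h ∷ r) = subst Reduced eq
  (reduced-glue (reverse w) (subst Reduced (unfold-reverse y w) (reduced-reverse r))
    (≢-invˡ-sym h ∷ [-]))
  where
  open ≡-Reasoning
  eq : reverse w ++ y ∷ x ∷ [] ≡ reverse (x ∷ y ∷ w)
  eq = begin
    reverse w ++ y ∷ x ∷ []   ≡⟨ ++-assoc (reverse w) [ y ] [ x ] ⟨
    (reverse w ∷ʳ y) ∷ʳ x     ≡⟨ cong (_∷ʳ x) (unfold-reverse y w) ⟨
    reverse (y ∷ w) ∷ʳ x      ≡⟨ unfold-reverse x (y ∷ w) ⟨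
    reverse (x ∷ y ∷ w)       ∎

reduced-pal-∷ʳ : {x : Letter Σ} {w : Word Σ} → Pal w → Reduced (x ∷ w) → Reduced (w ∷ʳ x)
reduced-pal-∷ʳ {x = x} {w} p r = subst Reduced
  (trans (unfold-reverse x w) (cong (_∷ʳ x) (sym (pal⇒palindrome p))))
  (reduced-reverse r)

-- At the right end the palindrome mirrors its junction with `x` on the left. If `w` is empty the
-- only pair is `x` next to itself, and no letter is its own inverse.
reduced-pal-wrap : {x : Letter Σ} {w : Word Σ} → Pal w → Reduced (x ∷ w) → Reduced (x ∷ w ∷ʳ x)
reduced-pal-wrap {x = x} {[]}    _ _         = x≢x⁻¹ x ∷ [-]
reduced-pal-wrap {w = _ ∷ _} p r@(h ∷ _) = h ∷ reduced-pal-∷ʳ p r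

reverse-pal-++ : {u v : Word Σ} → Pal u → Pal v → reverse (u ++ v) ≡ v ++ u
reverse-pal-++ {u = u} {v} p q = trans (reverse-++ u v)
  (sym (cong₂ _++_ (pal⇒palindrome q) (pal⇒palindrome p)))

-- Reversal in the free group

cancel-≈ : ∀ (u : Word Σ) {x y} v → y ≡ invˡ x → u ++ x ∷ y ∷ v ≈ u ++ v
cancel-≈ u v refl = fwd (cancel u _ v) ◅ ε

-- A cancelling pair read backwards is again a cancelling pair, so reversal descends to the free
-- group.
reverse-≈ : {u v : Word Σ} → u ≈ v → reverse u ≈ reverse v
reverse-≈ = EqC.gfold (EqC.isEquivalence _⟶_) reverse step
  where
  step : {u v : Word Σ} → u ⟶ v → reverse u ≈ reverse v
  step (cancel u x v) =
    ≈-reflexive (begin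
      reverse (u ++ x ∷ invˡ x ∷ v)                   ≡⟨ reverse-++ u _ ⟩
      reverse (x ∷ invˡ x ∷ v) ++ reverse u           ≡⟨ cong (_++ reverse u) (reverse-++ (x ∷ invˡ x ∷ []) v) ⟩
      (reverse v ++ invˡ x ∷ x ∷ []) ++ reverse u     ≡⟨ ++-assoc (reverse v) _ _ ⟩
      reverse v ++ invˡ x ∷ x ∷ reverse u             ∎)
    ◅◅ cancel-≈ (reverse v) (reverse u) (sym (invˡ-involutive x))
    ◅◅ ≈-reflexive (sym (reverse-++ u v))
    where open ≡-Reasoning

map-invˡ-involutive : ∀ (w : Word Σ) → map invˡ (map invˡ w) ≡ w
map-invˡ-involutive w = trans (sym (map-∘ w)) (trans (map-cong invˡ-involutive w) (map-id w))

-- By involutivity of `invˡ`, the word `reverse w` is `inv (map invˡ w)`.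
++-inverse-reverse : ∀ (w : Word Σ) → reverse w ++ map invˡ w ≈ []
++-inverse-reverse w =
  ≈-reflexive (cong (λ v → reverse v ++ map invˡ w) (sym (map-invˡ-involutive w)))
  ◅◅ ++-inverseˡ (map invˡ w)

sandwich-palindrome : ∀ (u : Word Σ) {p} → Palindrome p → Palindrome (u ++ p ++ reverse u)
sandwich-palindrome u {p} eq = sym (begin
  reverse (u ++ p ++ reverse u)                    ≡⟨ reverse-++ u _ ⟩
  reverse (p ++ reverse u) ++ reverse u            ≡⟨ cong (_++ reverse u) (reverse-++ p (reverse u)) ⟩
  (reverse (reverse u) ++ reverse p) ++ reverse u  ≡⟨ ++-assoc (reverse (reverse u)) _ _ ⟩
  reverse (reverse u) ++ reverse p ++ reverse u    ≡⟨ cong₂ (λ v q → v ++ q ++ reverse u) (reverse-involutive u) (sym eq) ⟩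
  u ++ p ++ reverse u                              ∎)
  where open ≡-Reasoning

-- Words of the shape A P Q A⁻¹

data Form {Σ : Set a} : Word Σ → Set a where
  core : ∀ {p q} → Pal p → Pal q → Form (p ++ q)
  wrap : ∀ x {w} → Form w → Form (x ∷ w ∷ʳ invˡ x)

-- Each `wrap` contributes one letter of A, outermost first, so induction on `Form` is induction on
-- A.
form⇒APQA⁻¹ : {w : Word Σ} → Form w →
  ∃[ A ] ∃[ P ] ∃[ Q ] Palindrome P × Palindrome Q × w ≡ A ++ P ++ Q ++ inv A
form⇒APQA⁻¹ (core {p} {q} pp pq) =
  [] , p , q , pal⇒palindrome pp , pal⇒palindrome pq , cong (p ++_) (sym (++-identityʳ q))
form⇒APQA⁻¹ (wrap x {w} f) with A , P , Q , pp , pq , eq ← form⇒APQA⁻¹ f =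
  x ∷ A , P , Q , pp , pq , cong (x ∷_) (begin
    w ∷ʳ invˡ x                            ≡⟨ cong (_∷ʳ invˡ x) eq ⟩
    (A ++ P ++ Q ++ inv A) ∷ʳ invˡ x       ≡⟨ ++-assoc A _ _ ⟩
    A ++ (P ++ Q ++ inv A) ∷ʳ invˡ x       ≡⟨ cong (A ++_) (++-assoc P _ _) ⟩
    A ++ P ++ (Q ++ inv A) ∷ʳ invˡ x       ≡⟨ cong (λ v → A ++ P ++ v) (++-assoc Q _ _) ⟩
    A ++ P ++ Q ++ inv A ∷ʳ invˡ x         ≡⟨ cong (λ v → A ++ P ++ Q ++ v) (inv-∷ x A) ⟨
    A ++ P ++ Q ++ inv (x ∷ A)             ∎)
  where open ≡-Reasoning

-- Reversal swaps P with Q and turns each conjugating letter into its inverse. This lets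
-- cancellation on the right be treated as cancellation on the left.
form-reverse : {w : Word Σ} → Form w → Form (reverse w)
form-reverse (core p q) = subst Form (sym (reverse-pal-++ p q)) (core q p)
form-reverse (wrap x {w} f) = subst Form
  (trans (cong (λ y → invˡ x ∷ reverse w ∷ʳ y) (invˡ-involutive x))
         (sym (reverse-∷-∷ʳ x w (invˡ x))))
  (wrap (invˡ x) (form-reverse f))

-- Asking for some reduced word in the class of `g` makes the property transportable along `≈`;
-- uniqueness of reduced forms recovers `reducedForm g` at the end.
HasForm : {Σ : Set a} → Word Σ → Set a
HasForm g = ∃[ w ] Form w × Reduced w × g ≈ w

hasForm-≈ : {g h : Word Σ} → g ≈ h → HasForm h → HasForm g
hasForm-≈ g≈h (w , f , r , h≈w) = w , f , r , g≈h ◅◅ h≈w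

hasForm-reverse : {g : Word Σ} → HasForm g → HasForm (reverse g)
hasForm-reverse (w , f , r , g≈w) =
  reverse w , form-reverse f , reduced-reverse r , reverse-≈ g≈w

reduced⇒hasForm : {w : Word Σ} → Form w → Reduced w → HasForm w
reduced⇒hasForm f r = _ , f , r , ε

pal⇒hasForm : {w : Word Σ} → Pal w → Reduced w → HasForm w
pal⇒hasForm p = reduced⇒hasForm (core nil p)

conj-core-cancel : ∀ x {p q : Word Σ} → Pal (invˡ x ∷ p) → Pal q → Reduced (invˡ x ∷ p ++ q) →
  HasForm (x ∷ (invˡ x ∷ p ++ q) ∷ʳ invˡ x)
conj-core-cancel x {q = q} (single _) pq r =
  hasForm-≈ (cancel-≈ [] (q ∷ʳ invˡ x) refl)
    (reduced⇒hasForm (core pq (single (invˡ x))) (reduced-pal-∷ʳ pq r))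
conj-core-cancel x {q = q} (wrap _ {p} pp) pq r =
  hasForm-≈
    (cancel-≈ [] _ refl
     ◅◅ ≈-reflexive (trans (++-assoc (p ∷ʳ invˡ x) q _) (++-assoc p _ _)))
    -- The pieces p x⁻¹ and x⁻¹ q x⁻¹ are glued at their common x⁻¹. The first, and x⁻¹ q inside the
    -- second, are factors of the given reduced word.
    (reduced⇒hasForm (core pp (wrap (invˡ x) pq))
      (reduced-glue p (reduced-++ˡ (p ∷ʳ invˡ x) (Linked.tail r))
        (reduced-pal-wrap pq (reduced-++ʳ p r′))))
  where
  r′ : Reduced (p ++ invˡ x ∷ q)
  r′ = subst Reduced (++-assoc p [ invˡ x ] q) (Linked.tail r)

module _ {Σ : Set a} (_≟_ : DecidableEquality Σ) where
  open ReducedForm _≟_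
  open ≈-Reasoning (Group.setoid (freeGroup Σ))

  reducedForm-reverse : ∀ w → reducedForm (reverse w) ≡ reverse (reducedForm w)
  reducedForm-reverse w = reducedForm-unique (reduced-reverse (reducedForm-reduced w))
    (reverse-≈ (reducedForm-≈ w))

  palindrome⇒isPalindrome : ∀ {w} → Palindrome w → IsPalindrome w
  palindrome⇒isPalindrome {w} eq = trans (cong reducedForm eq) (reducedForm-reverse w)

  -- Closure under conjugation by a letter

  extend-∷ : ∀ x {b} {p q : Word Σ} → Pal (b ∷ p) → Pal q → Reduced (b ∷ p ++ q) →
    Reduced (x ∷ b ∷ p ++ q) ⊎ HasForm (x ∷ (b ∷ p ++ q) ∷ʳ invˡ x)
  extend-∷ x {b} pp pq r with b ≟ˡ invˡ x
  ... | yes refl   = inj₂ (conj-core-cancel x pp pq r)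
  ... | no  b≢x⁻¹ = inj₁ (b≢x⁻¹ ∷ r)

  -- Either `x` meets no inverse on its right, or rebalancing settles the whole conjugate. When `p`
  -- is empty, `q` takes its place, followed by an empty second palindrome.
  extend : ∀ x {p q : Word Σ} → Pal p → Pal q → Reduced (p ++ q) →
    Reduced (x ∷ p ++ q) ⊎ HasForm (x ∷ (p ++ q) ∷ʳ invˡ x)
  extend x {[]} {[]}    _  _  _ = inj₁ [-]
  extend x {[]} {b ∷ q} _  pq r =
    subst (λ w → Reduced (x ∷ w) ⊎ HasForm (x ∷ w ∷ʳ invˡ x)) (++-identityʳ (b ∷ q))
      (extend-∷ x pq nil (subst Reduced (sym (++-identityʳ (b ∷ q))) r))
  extend x {_ ∷ _} pp pq r = extend-∷ x pp pq r

  conj-reduced : ∀ x {w : Word Σ} → Form w → Reduced (x ∷ w) → Reduced (w ∷ʳ invˡ x) →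
    HasForm (x ∷ w ∷ʳ invˡ x)
  -- Both adjacency hypotheses hold trivially around the empty word, yet x x⁻¹ cancels.
  conj-reduced x {[]}    _ _       _ = hasForm-≈ (cancel-≈ [] [] refl) (pal⇒hasForm nil [])
  conj-reduced x {_ ∷ _} f (h ∷ _) r = reduced⇒hasForm (wrap x f) (h ∷ r)

  conj-form : ∀ x {w : Word Σ} → Form w → Reduced w → HasForm (x ∷ w ∷ʳ invˡ x)
  conj-form x (wrap b {w} f) r with b ≟ˡ invˡ x
  ... | yes refl = hasForm-≈
    (begin
      x ∷ (invˡ x ∷ w ∷ʳ invˡ (invˡ x)) ∷ʳ invˡ x  ≈⟨ cancel-≈ [] _ refl ⟩
      (w ∷ʳ invˡ (invˡ x)) ∷ʳ invˡ x               ≡⟨ ++-assoc w _ _ ⟩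
      w ++ invˡ (invˡ x) ∷ invˡ x ∷ []             ≈⟨ cancel-≈ w [] (sym (invˡ-involutive (invˡ x))) ⟩
      w ++ []                                      ≡⟨ ++-identityʳ w ⟩
      w                                            ∎)
    (reduced⇒hasForm f (reduced-++ˡ w (Linked.tail r)))
  ... | no b≢x⁻¹ = conj-reduced x (wrap b f) (b≢x⁻¹ ∷ r)
    (subst Reduced (sym (++-assoc (b ∷ w) _ _))
      (reduced-glue (b ∷ w) r
        -- On the right, b⁻¹ meets x⁻¹; they cancel exactly when b is x⁻¹, the case already excluded
        -- on the left.
        ((λ eq → b≢x⁻¹ (sym (trans eq (invˡ-involutive b)))) ∷ [-])))
  conj-form x (core {p} {q} pp pq) r
    with extend x pp pq r
       -- The right end is tested in the mirror image: `p ++ q` reverses to `q ++ p`, and appending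
       -- `invˡ x` becomes prepending it.
       | extend (invˡ x) pq pp (subst Reduced (reverse-pal-++ pp pq) (reduced-reverse r))
  ... | inj₂ h | _      = h
  ... | inj₁ _ | inj₂ h = subst HasForm eq (hasForm-reverse h)
    where
    eq : reverse (invˡ x ∷ (q ++ p) ∷ʳ invˡ (invˡ x)) ≡ x ∷ (p ++ q) ∷ʳ invˡ x
    eq = trans (reverse-∷-∷ʳ (invˡ x) (q ++ p) _)
      (cong₂ (λ y w → y ∷ w ∷ʳ invˡ x) (invˡ-involutive x) (reverse-pal-++ pq pp))
  ... | inj₁ rˡ | inj₁ rʳ = conj-reduced x (core pp pq) rˡ
    (subst Reduced
      (trans (unfold-reverse (invˡ x) (q ++ p)) (cong (_∷ʳ invˡ x) (reverse-pal-++ pq pp)))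
      (reduced-reverse rʳ))

  conj-hasForm : ∀ x {g : Word Σ} → HasForm g → HasForm (x ∷ g ∷ʳ invˡ x)
  conj-hasForm x (w , f , r , g≈w) =
    hasForm-≈ (++-congˡ [ x ] (++-congʳ [ invˡ x ] g≈w)) (conj-form x f r)

  -- Products of two palindromes

  letter-pal-hasForm : ∀ x {q : Word Σ} → Pal q → Reduced q → HasForm (x ∷ q)
  letter-pal-hasForm x {[]}    _ _ = pal⇒hasForm (single x) [-]
  letter-pal-hasForm x {b ∷ q} p r with b ≟ˡ invˡ x
  ... | no b≢x⁻¹ = reduced⇒hasForm (core (single x) p) (b≢x⁻¹ ∷ r)
  letter-pal-hasForm x (single _) r | yes refl =
    hasForm-≈ (cancel-≈ [] [] refl) (pal⇒hasForm nil [])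
  letter-pal-hasForm x (wrap _ {q} p) r | yes refl =
    hasForm-≈ (cancel-≈ [] (q ∷ʳ invˡ x) refl)
      (reduced⇒hasForm (core p (single (invˡ x))) (Linked.tail r))

  -- Induction on `p` moves its outer letter onto `q`. It ranges over arbitrary palindromic words
  -- because x q x may contain cancelling pairs even when q is reduced.
  pal-++-hasForm : ∀ {p q : Word Σ} → Pal p → Palindrome q → HasForm (p ++ q)
  pal-++-hasForm {q = q} nil eq = hasForm-≈ (reducedForm-≈ q)
    (pal⇒hasForm (palindrome⇒pal (palindrome⇒isPalindrome eq)) (reducedForm-reduced q))
  pal-++-hasForm {q = q} (single x) eq = hasForm-≈ (++-congˡ [ x ] (reducedForm-≈ q))
    (letter-pal-hasForm x (palindrome⇒pal (palindrome⇒isPalindrome eq)) (reducedForm-reduced q))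
  pal-++-hasForm {q = q} (wrap x {p} pp) eq = hasForm-≈
    (begin
      x ∷ (p ∷ʳ x) ++ q                      ≡⟨ cong (x ∷_) (++-assoc p [ x ] q) ⟩
      x ∷ p ++ x ∷ q                         ≡⟨ cong (x ∷_) (++-identityʳ _) ⟨
      -- Inserting x x⁻¹ at the end exposes a conjugate by x of the shorter product p (x q x).
      x ∷ (p ++ x ∷ q) ++ []                 ≈⟨ cancel-≈ (x ∷ p ++ x ∷ q) [] refl ⟨
      x ∷ (p ++ x ∷ q) ++ x ∷ invˡ x ∷ []    ≡⟨ cong (x ∷_) (++-assoc (p ++ x ∷ q) [ x ] [ invˡ x ]) ⟨
      x ∷ ((p ++ x ∷ q) ∷ʳ x) ∷ʳ invˡ x      ≡⟨ cong (λ w → x ∷ w ∷ʳ invˡ x) (++-assoc p (x ∷ q) [ x ]) ⟩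
      x ∷ (p ++ x ∷ q ∷ʳ x) ∷ʳ invˡ x        ∎)
    (conj-hasForm x (pal-++-hasForm pp (sandwich-palindrome [ x ] eq)))

  product⇒hasForm : ∀ {g} → IsProductOfAtMostTwoPalindromes g → HasForm g
  product⇒hasForm ([] , _ , _ , g≈) = hasForm-≈ g≈ (pal⇒hasForm nil [])
  product⇒hasForm (p ∷ [] , _ , pp ∷ [] , g≈) =
    -- The empty word left by the fold serves as the second palindrome.
    hasForm-≈ (g≈ ◅◅ ++-congʳ [] (reducedForm-≈ p)) (pal-++-hasForm (palindrome⇒pal pp) refl)
  product⇒hasForm (p ∷ q ∷ [] , _ , pp ∷ pq ∷ [] , g≈) =
    hasForm-≈
      (g≈ ◅◅ ++-cong (reducedForm-≈ p) (≈-reflexive (++-identityʳ q) ◅◅ reducedForm-≈ q))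
      (pal-++-hasForm (palindrome⇒pal pp) pq)
  product⇒hasForm (_ ∷ _ ∷ _ ∷ _ , s≤s (s≤s ()) , _)

  -- Splitting A P Q A⁻¹ into two palindromes

  APQA⁻¹⇒product : ∀ {g} A {P Q} → Palindrome P → Palindrome Q →
    reducedForm g ≡ A ++ P ++ Q ++ inv A → IsProductOfAtMostTwoPalindromes g
  APQA⁻¹⇒product {g} A {P} {Q} pp pq eq =
    -- `map invˡ A` is the inverse of `reverse A`, and its own reversal is `inv A` by definition, so
    -- both factors are sandwiches of a palindrome.
    (A ++ P ++ reverse A) ∷ (map invˡ A ++ Q ++ inv A) ∷ [] , s≤s (s≤s z≤n)
    , palindrome⇒isPalindrome (sandwich-palindrome A pp)
      ∷ palindrome⇒isPalindrome (sandwich-palindrome (map invˡ A) pq) ∷ []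
    , (begin
      g                                                          ≈⟨ reducedForm-≈ g ⟩
      reducedForm g                                              ≡⟨ eq ⟩
      A ++ P ++ Q ++ inv A                                       ≈⟨ ++-congˡ A (++-congˡ P (++-congʳ (Q ++ inv A) (++-inverse-reverse A))) ⟨
      A ++ P ++ (reverse A ++ map invˡ A) ++ Q ++ inv A          ≡⟨ cong (λ w → A ++ P ++ w) (++-assoc (reverse A) _ _) ⟩
      A ++ P ++ reverse A ++ map invˡ A ++ Q ++ inv A            ≡⟨ cong (A ++_) (++-assoc P (reverse A) _) ⟨
      A ++ (P ++ reverse A) ++ map invˡ A ++ Q ++ inv A          ≡⟨ ++-assoc A (P ++ reverse A) _ ⟨
      (A ++ P ++ reverse A) ++ map invˡ A ++ Q ++ inv A          ≡⟨ cong ((A ++ P ++ reverse A) ++_) (++-identityʳ _) ⟨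
      (A ++ P ++ reverse A) ++ (map invˡ A ++ Q ++ inv A) ++ []  ∎)

theorem1 : ∀ {a} {Σ : Set a} (_≟_ : DecidableEquality Σ) (g : Group.Carrier (freeGroup Σ)) →
    ReducedForm.IsProductOfAtMostTwoPalindromes _≟_ g
    ⇔ (∃[ A ] ∃[ P ] ∃[ Q ] Palindrome P × Palindrome Q ×
    ReducedForm.reducedForm _≟_ g ≡ A ++ P ++ Q ++ inv A)
theorem1 _≟_ g = mk⇔ to (λ (A , _ , _ , pp , pq , eq) → APQA⁻¹⇒product _≟_ A pp pq eq)
  where
  open ReducedForm _≟_
  to : IsProductOfAtMostTwoPalindromes g →
    ∃[ A ] ∃[ P ] ∃[ Q ] Palindrome P × Palindrome Q × reducedForm g ≡ A ++ P ++ Q ++ inv A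
  to prod with w , f , r , g≈w ← product⇒hasForm _≟_ prod =
    subst (λ v → ∃[ A ] ∃[ P ] ∃[ Q ] Palindrome P × Palindrome Q × v ≡ A ++ P ++ Q ++ inv A)
      (sym (reducedForm-unique r g≈w)) (form⇒APQA⁻¹ f)
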